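{- For every integer $l\geq 2$, $$S(l,l)\geq \binom{2l}{l}+\binom{2l-3}{l-1}.$$
   Context: A 0-1 matrix $N$ with $a$ rows and $b$ columns can be found in a collection of sets $\mathcal{H}$ if there are distinct sets $H_1,\dots,H_a\in\mathcal{H}$ and distinct elements $e_1,\dots,e_b\in\bigcup_{H\in\mathcal{H}}H$ such that $N_{\alpha,\beta}=1$ if and only if $e_\beta\in H_\alpha$. For an integer $n\ge 1$, the following matrices have $n+1$ rows and $n$ columns with entries in $\{0,1\}$: the $n$-singleton matrix $S^n$, with $S^n_{i,j}=1$ iff $i=j+1$; the $n$-cosingleton matrix $\bar S^n$, with $\bar S^n_{i,j}=0$ iff $i=j$; the $n$-monotone matrix $M^n$, with $M^n_{i,j}=1$ iff $i\ge j+1$. For non-negative integers $k,l$, $S(k,l)$ is the smallest non-negative integer $S$ such that for every collection of distinct sets $\mathcal{H}$ with $|\mathcal{H}|>S$, at least one of $S^{k+1}$, $\bar S^{l+1}$, $M^{\min(k+1,l+1)}$ can be found in $\mathcal{H}$ (such an integer exists). -}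

module Defs where

open import Data.Bool using (Bool; true; not)
open import Data.Fin using (Fin; toℕ)
open import Data.Nat using (ℕ; suc; _⊓_; _≤_; _≤?_; _≟_)
open import Data.Product using (Σ-syntax; ∃-syntax; _×_)
open import Data.Sum using (_⊎_)
open import Function.Bundles using (_↣_; _⇔_; module Injection)
open import Relation.Binary.PropositionalEquality using (_≡_; _≢_)
open import Relation.Nullary.Decidable using (⌊_⌋)

open Injection using (to)

-- `true` is the entry 1.  Indices start at 0, so the (i , j) entry here is
-- the (i + 1 , j + 1) entry in the usual 1-based numbering; the conditions
-- below compare i with j and are unaffected by shifting both.
Matrix : ℕ → ℕ → Set
Matrix a b = Fin a → Fin b → Bool

singleton : ∀ n → Matrix (suc n) n
singleton n i j = ⌊ toℕ i ≟ suc (toℕ j) ⌋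

cosingleton : ∀ n → Matrix (suc n) n
cosingleton n i j = not ⌊ toℕ i ≟ toℕ j ⌋

monotone : ∀ n → Matrix (suc n) n
monotone n i j = ⌊ suc (toℕ j) ≤? toℕ i ⌋

-- Both the collection and its sets may be infinite.  Sets are given by
-- their characteristic functions, and two sets are distinct when some
-- element lies in exactly one of them: classically these are arbitrary
-- subsets of `Elem` and ordinary inequality of sets.
record Collection : Set₁ where
  field
    Elem     : Set
    Index    : Set
    member   : Index → Elem → Bool
    distinct : ∀ {i j} → i ≢ j → ∃[ x ] member i x ≢ member j x

  infix 4 _∈[_]

  _∈[_] : Elem → Index → Set
  x ∈[ i ] = member i x ≡ true

  ⋃ : Elem → Set
  ⋃ x = ∃[ i ] x ∈[ i ]

open Collection

infix 4 _Exceeds_ _FoundIn_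

_Exceeds_ : Collection → ℕ → Set
H Exceeds s = Fin (suc s) ↣ Index H

_FoundIn_ : ∀ {a b} → Matrix a b → Collection → Set
_FoundIn_ {a} {b} N H =
  Σ[ row ∈ Fin a ↣ Index H ] Σ[ col ∈ Fin b ↣ Elem H ]
    (∀ β → ⋃ H (to col β)) ×
    (∀ α β → N α β ≡ true ⇔ _∈[_] H (to col β) (to row α))

Forces : ℕ → ℕ → ℕ → Set₁
Forces k l s = ∀ (H : Collection) → H Exceeds s →
  singleton (suc k) FoundIn H ⊎
  cosingleton (suc l) FoundIn H ⊎
  monotone (suc k ⊓ suc l) FoundIn H

-- `IsS k l s` says that s is the number S(k , l).
IsS : ℕ → ℕ → ℕ → Set₁
IsS k l s = Forces k l s × (∀ t → Forces k l t → s ≤ t)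

-- On the 2l points a, b, d, 1, …, 2l ∸ 3 take all l-sets, except that an l-set
-- meeting {a, b, d} in {b} receives d as an additional element; then add all
-- (l ∸ 1)-subsets of {1, …, 2l ∸ 3}.
-- A row of l + 1 ones needs a set F ∪ {b, d} of size l + 1, and its columns
-- are then exactly F ∪ {b, d}; a row of l + 1 zeros needs one of the
-- additional sets, and its columns are then exactly the complement, which
-- contains a, b and d.
-- Monotone matrix: it has both rows, so a both is and is not a column.
-- Singleton matrix: the row of column b meets {a, b, d} in {b}, which no
-- member of the collection does.
-- Cosingleton matrix: the row missing only d contains F ∪ {b} but not d; it is
-- either excluded in the same way or has l + 1 elements and avoids d.
module Submission where

open import Data.Bool using (true; false; not)
import Data.Bool.Properties as Bool
open import Data.Fin as Fin using (Fin; zero; suc; toℕ; fromℕ; inject₁; inject≤)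
open import Data.Fin.Properties
  using (+↔⊎; any?; inject≤-injective; suc-injective; toℕ-fromℕ; toℕ-inject₁;
         toℕ-injective; toℕ<n; ¬∀⟶∃¬)
open import Data.Fin.Subset
  using (Subset; inside; outside; _∈_; _∉_; _⊆_; ∣_∣; ∁; ⊥; _-_)
open import Data.Fin.Subset.Properties
  using (∣⊥∣≡0; ∣p∣≤n; ∣∁p∣≡n∸∣p∣; p⊆q⇒∣p∣≤∣q∣; x∈p⇒∣p-x∣<∣p∣;
         x∈p∧x≢y⇒x∈p-y; x∉p⇒x∈∁p)
open import Data.Nat using (ℕ; zero; suc; _+_; _*_; _∸_; _≤_; _<_; _≥_; z≤n)
open import Data.Nat.Combinatorics using (_C_; nCk+nC[k+1]≡[n+1]C[k+1])
open import Data.Nat.Properties as ℕ using (≤-trans; ≤-<-trans; ≤-reflexive)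
open import Data.Product using (Σ-syntax; ∃-syntax; _×_; _,_; proj₁; proj₂)
open import Data.Sum using (_⊎_; inj₁; inj₂; [_,_]′)
open import Data.Sum.Function.Propositional using (_⊎-↣_)
open import Data.Vec using (_∷_; here; there; lookup)
open import Data.Vec.Properties
  using ([]=⇒lookup; lookup⇒[]=; tabulate∘lookup; tabulate-cong; ∷-injectiveʳ)
open import Function using (_∘_)
open import Function.Bundles
  using (_↣_; mk↣; module Injection; module Equivalence)
open import Function.Construct.Composition using (_↣-∘_)
open import Function.Definitions using (Injective)
open import Function.Properties.Inverse using (Inverse⇒Injection)
open import Relation.Binary.PropositionalEquality
  using (_≡_; _≢_; refl; sym; trans; cong; cong₂; subst)
open import Relation.Nullary using (¬_; Dec; yes; no; contradiction)
open import Relation.Nullary.Decidable using (⌊_⌋; isYes≗does; dec-true; dec-false)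
open import Defs

open Injection using (to; injective)

private variable
  m n k : ℕ

⌊⌋-true : ∀ {P : Set} (P? : Dec P) → P → ⌊ P? ⌋ ≡ true
⌊⌋-true P? p = trans (isYes≗does P?) (dec-true P? p)

⌊⌋-false : ∀ {P : Set} (P? : Dec P) → ¬ P → ⌊ P? ⌋ ≡ false
⌊⌋-false P? ¬p = trans (isYes≗does P?) (dec-false P? ¬p)

toℕ<toℕ-fromℕ : ∀ (i : Fin n) → toℕ i < toℕ (fromℕ n)
toℕ<toℕ-fromℕ {n} i = subst (toℕ i <_) (sym (toℕ-fromℕ n)) (toℕ<n i)

-- Subsets of a given size

Layer : ℕ → ℕ → Set
Layer n k = Σ[ p ∈ Subset n ] ∣ p ∣ ≡ k

Layer-≡ : {P Q : Layer n k} → proj₁ P ≡ proj₁ Q → P ≡ Q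
Layer-≡ {P = p , e} {Q = .p , e′} refl = cong (p ,_) (ℕ.≡-irrelevant e e′)

Layer-∷ : (Layer n k ⊎ Layer n (suc k)) ↣ Layer (suc n) (suc k)
Layer-∷ {n} {k} = mk↣ {to = cons} cons-injective
  where
  cons : Layer n k ⊎ Layer n (suc k) → Layer (suc n) (suc k)
  cons (inj₁ (p , e)) = inside ∷ p , cong suc e
  cons (inj₂ (p , e)) = outside ∷ p , e

  cons-injective : Injective _≡_ _≡_ cons
  cons-injective {inj₁ _} {inj₁ _} eq = cong inj₁ (Layer-≡ (∷-injectiveʳ (cong proj₁ eq)))
  cons-injective {inj₁ _} {inj₂ _} eq with () ← cong proj₁ eq
  cons-injective {inj₂ _} {inj₁ _} eq with () ← cong proj₁ eq
  cons-injective {inj₂ _} {inj₂ _} eq = cong inj₂ (Layer-≡ (∷-injectiveʳ (cong proj₁ eq)))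

-- Induction along Pascal's rule; `Layer-∷` sorts the subsets by whether they contain the first
-- point.
nCk↣Layer : ∀ n k → Fin (n C k) ↣ Layer n k
nCk↣Layer n zero = mk↣ {to = λ _ → ⊥ , ∣⊥∣≡0 n} Fin1-injective
  where
  Fin1-injective : ∀ {A : Set} {f : Fin 1 → A} → Injective _≡_ _≡_ f
  Fin1-injective {x = zero} {zero} _ = refl
nCk↣Layer zero (suc k) = mk↣ {to = λ ()} λ {x} → contradiction x λ ()
nCk↣Layer (suc n) (suc k) =
  subst (λ c → Fin c ↣ Layer (suc n) (suc k)) (nCk+nC[k+1]≡[n+1]C[k+1] n k)
    (Layer-∷ ↣-∘ ((nCk↣Layer n k ⊎-↣ nCk↣Layer n (suc k)) ↣-∘ Inverse⇒Injection +↔⊎))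

-- Injections into subsets

↣⇒≤∣∣ : ∀ (f : Fin k ↣ Fin n) {p} → (∀ β → to f β ∈ p) → k ≤ ∣ p ∣
↣⇒≤∣∣ {zero}  f f∈p = z≤n
↣⇒≤∣∣ {suc k} f {p} f∈p =
  ≤-<-trans
    (↣⇒≤∣∣ (f ↣-∘ mk↣ suc-injective) {p - to f zero} λ β →
      x∈p∧x≢y⇒x∈p-y (f∈p (suc β)) (λ e → contradiction (injective f e) λ ()))
    (x∈p⇒∣p-x∣<∣p∣ (f∈p zero))

-- If `x` were missed, `f` would map into `p - x`, which has fewer than `k` elements.
↣-covers : ∀ (f : Fin k ↣ Fin n) {p x} → (∀ β → to f β ∈ p) → ∣ p ∣ ≤ k →
           x ∈ p → ∃[ β ] to f β ≡ x
↣-covers f {p} {x} f∈p ∣p∣≤k x∈p with any? (λ β → to f β Fin.≟ x)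
... | yes found = found
... | no ¬found = contradiction
  (≤-<-trans
    (↣⇒≤∣∣ f {p - x} (λ β → x∈p∧x≢y⇒x∈p-y (f∈p β) λ e → ¬found (β , e)))
    (x∈p⇒∣p-x∣<∣p∣ x∈p))
  (ℕ.≤⇒≯ ∣p∣≤k)

lookup-injective : ∀ {p q : Subset n} → (∀ x → lookup p x ≡ lookup q x) → p ≡ q
lookup-injective {p = p} {q} eq =
  trans (sym (tabulate∘lookup p)) (trans (tabulate-cong eq) (tabulate∘lookup q))

fromSubsets : ∀ {I : Set} → I ↣ Subset n → Collection
fromSubsets {n = n} {I} f = record
  { Elem     = Fin n
  ; Index    = I
  ; member   = lookup ∘ to f
  ; distinct = λ {i} {j} i≢j →
      -- Agreement at every point would force `i ≡ j`; a point of disagreement is then found by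
      -- finite search.
      ¬∀⟶∃¬ n _ (λ x → lookup (to f i) x Bool.≟ lookup (to f j) x)
        (i≢j ∘ injective f ∘ lookup-injective)
  }

-- The points zero, suc zero and suc (suc zero) are a, b and d.

pattern a = zero
pattern b = suc zero
pattern d = suc (suc zero)

twist : Subset (3 + m) → Subset (3 + m)
twist (outside ∷ inside ∷ outside ∷ F) = outside ∷ inside ∷ inside ∷ F
twist p = p

-- `fixed` records `twist p ≡ p` because the catch-all clause of `twist` does not reduce on a
-- variable.
data TwistView : Subset (3 + m) → Set where
  twisted : ∀ (F : Subset m) → TwistView (outside ∷ inside ∷ outside ∷ F)
  fixed   : ∀ {p : Subset (3 + m)} → (∀ F → p ≢ outside ∷ inside ∷ outside ∷ F) →
            twist p ≡ p → TwistView p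

twistView : ∀ (p : Subset (3 + m)) → TwistView p
twistView (inside  ∷ _)                    = fixed (λ _ ()) refl
twistView (outside ∷ outside ∷ _)          = fixed (λ _ ()) refl
twistView (outside ∷ inside ∷ inside  ∷ _) = fixed (λ _ ()) refl
twistView (outside ∷ inside ∷ outside ∷ F) = twisted F

∣twist∣≥ : ∀ (p : Subset (3 + m)) → ∣ p ∣ ≤ ∣ twist p ∣
∣twist∣≥ p with twistView p
... | twisted F  = ℕ.n≤1+n _
... | fixed _ eq = ≤-reflexive (sym (cong ∣_∣ eq))

-- F ∪ {b} and F ∪ {b, d} have the same image. Equal sizes exclude this: twisting adds one element,
-- so a twisted and a fixed set end up with different sizes.
twist-injective : ∀ (p q : Subset (3 + m)) → ∣ p ∣ ≡ ∣ q ∣ → twist p ≡ twist q → p ≡ q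
twist-injective p q ∣p∣≡∣q∣ eq with twistView p | twistView q
... | twisted F  | twisted _ with refl ← eq = refl
... | twisted F  | fixed _ e =
  contradiction (trans (cong ∣_∣ (trans eq e)) (sym ∣p∣≡∣q∣)) ℕ.1+n≢n
... | fixed _ e  | twisted F =
  contradiction (trans (cong ∣_∣ (trans (sym eq) e)) ∣p∣≡∣q∣) ℕ.1+n≢n
... | fixed _ e  | fixed _ e′ = trans (sym e) (trans eq e′)

-- `suc k` plays the role of l; `m` counts the points other than a, b, d and is tied to l by `size`
-- below.
module Construction (m k : ℕ) where

  Member : Set
  Member = Layer (3 + m) (suc k) ⊎ Layer m k

  set : Member → Subset (3 + m)
  set (inj₁ (p , _)) = twist p
  set (inj₂ (F , _)) = outside ∷ outside ∷ outside ∷ F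

  set₁≢set₂ : ∀ P Q → set (inj₁ P) ≢ set (inj₂ Q)
  set₁≢set₂ (p , ∣p∣) (F , ∣F∣) eq =
    ℕ.<⇒≱ (≤-reflexive (trans (cong suc ∣F∣) (sym ∣p∣)))
      (≤-trans (∣twist∣≥ p) (≤-reflexive (cong ∣_∣ eq)))

  set-injective : Injective _≡_ _≡_ set
  set-injective {inj₁ (p , e)} {inj₁ (q , e′)} eq =
    cong inj₁ (Layer-≡ (twist-injective p q (trans e (sym e′)) eq))
  set-injective {inj₁ P} {inj₂ Q} eq = contradiction eq (set₁≢set₂ P Q)
  set-injective {inj₂ P} {inj₁ Q} eq = contradiction (sym eq) (set₁≢set₂ Q P)
  set-injective {inj₂ _} {inj₂ _} refl = cong inj₂ (Layer-≡ refl)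

  family : Collection
  family = fromSubsets (mk↣ set-injective)

  -- An l-set of this shape has been twisted away. The added sets omit b, so unification refutes the
  -- case `inj₂`.
  set≢oio : ∀ i F → set i ≢ outside ∷ inside ∷ outside ∷ F
  set≢oio (inj₁ (p , _)) F eq with twistView p
  ... | twisted _ with () ← eq
  ... | fixed ¬oio e = ¬oio F (trans (sym e) eq)

  b∈set⇒a∈⊎d∈ : ∀ i → b ∈ set i → a ∉ set i → ¬ d ∉ set i
  -- `set≢oio i` is abstracted along with `set i` so that it speaks of the matched shape.
  b∈set⇒a∈⊎d∈ i b∈ a∉ d∉ with set i | set≢oio i
  ... | inside  ∷ _                         | _    = a∉ here
  ... | outside ∷ outside ∷ _               | _    with there () ← b∈
  ... | outside ∷ inside  ∷ inside  ∷ _     | _    = d∉ (there (there here))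
  ... | outside ∷ inside  ∷ outside ∷ F     | ≢oio = ≢oio F refl

  large-set : ∀ i → suc k < ∣ set i ∣ →
              ∃[ F ] set i ≡ outside ∷ inside ∷ inside ∷ F × ∣ F ∣ ≡ k
  large-set (inj₁ (p , e)) lt with twistView p
  ... | twisted F  = F , refl , ℕ.suc-injective e
  ... | fixed _ eq = contradiction (trans (cong ∣_∣ eq) e) (ℕ.>⇒≢ lt)
  large-set (inj₂ (F , e)) lt = contradiction (ℕ.n≤1+n k) (ℕ.<⇒≱ (subst (suc k <_) e lt))

  small-set : ∀ i → ∣ set i ∣ ≤ k →
              ∃[ F ] set i ≡ outside ∷ outside ∷ outside ∷ F × ∣ F ∣ ≡ k
  small-set (inj₁ (p , e)) le =
    contradiction (≤-trans (∣twist∣≥ p) le) (ℕ.<⇒≱ (≤-reflexive (sym e)))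
  small-set (inj₂ (F , e)) le = F , refl , e

  full-row : ∀ i (f : Fin (2 + k) ↣ Fin (3 + m)) → (∀ β → to f β ∈ set i) →
             ∃[ F ] set i ≡ outside ∷ inside ∷ inside ∷ F × ∣ F ∣ ≡ k ×
             (∀ {x} → x ∈ set i → ∃[ β ] to f β ≡ x)
  full-row i f f∈ with large-set i (↣⇒≤∣∣ f f∈)
  ... | F , eq , ∣F∣ =
    F , eq , ∣F∣ , ↣-covers f f∈ (≤-reflexive (trans (cong ∣_∣ eq) (cong (2 +_) ∣F∣)))

  -- If a were in the set, it would contain F ∪ {a, b}, hence have l + 1 elements and be a twisted
  -- set, but those omit a. So the set would meet {a, b, d} in {b}.
  no-set-missing-only-d : ∀ i F → ∣ F ∣ ≡ k → d ∉ set i →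
           ¬ (∀ {x} → x ∈ outside ∷ inside ∷ inside ∷ F → x ≢ d → x ∈ set i)
  no-set-missing-only-d i F ∣F∣ d∉ ⊇ = b∈set⇒a∈⊎d∈ i (⊇ (there here) λ ()) a∉ d∉
    where
    ab∪F⊆ : a ∈ set i → inside ∷ inside ∷ outside ∷ F ⊆ set i
    ab∪F⊆ a∈ here = a∈
    ab∪F⊆ a∈ (there here) = ⊇ (there here) λ ()
    ab∪F⊆ a∈ (there (there (there x∈))) = ⊇ (there (there (there x∈))) λ ()

    a∉ : a ∉ set i
    a∉ a∈ with _ , eq , _ ← large-set i
      (≤-trans (≤-reflexive (cong (2 +_) (sym ∣F∣))) (p⊆q⇒∣p∣≤∣q∣ (ab∪F⊆ a∈)))
      with () ← subst (a ∈_) eq a∈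

  module _ (size : 3 + m ≡ 2 + k + k) where

    -- The l + 1 columns lie in the complement, so at most l ∸ 1 of the 2l points are in the set. By
    -- `small-set` it has exactly l ∸ 1, and the columns fill the complement.
    zero-row : ∀ i (f : Fin (2 + k) ↣ Fin (3 + m)) → (∀ β → to f β ∉ set i) →
               ∃[ F ] set i ≡ outside ∷ outside ∷ outside ∷ F ×
               (∀ {x} → x ∉ set i → ∃[ β ] to f β ≡ x)
    zero-row i f f∉ with small-set i ∣set∣≤k
      where
      ∣set∣≤k : ∣ set i ∣ ≤ k
      ∣set∣≤k = ℕ.+-cancelˡ-≤ (2 + k) _ _ (subst (2 + k + ∣ set i ∣ ≤_) size
        (ℕ.m≤o∸n⇒m+n≤o (2 + k) (∣p∣≤n (set i))
          (subst (2 + k ≤_) (∣∁p∣≡n∸∣p∣ (set i)) (↣⇒≤∣∣ f (x∉p⇒x∈∁p ∘ f∉)))))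
    ... | F , eq , ∣F∣ = F , eq , ↣-covers f (x∉p⇒x∈∁p ∘ f∉) (≤-reflexive ∣∁∣) ∘ x∉p⇒x∈∁p
      where
      ∣∁∣ : ∣ ∁ (set i) ∣ ≡ 2 + k
      ∣∁∣ = trans (∣∁p∣≡n∸∣p∣ (set i))
        (trans (cong₂ _∸_ size (trans (cong ∣_∣ eq) ∣F∣)) (ℕ.m+n∸n≡m (2 + k) k))

    -- Absence of the three matrices

    module Found {r} {N : Matrix r (2 + k)} (found : N FoundIn family) where

      col : Fin (2 + k) ↣ Fin (3 + m)
      col = proj₁ (proj₂ found)

      row : Fin r → Subset (3 + m)
      row α = set (to (proj₁ found) α)

      ones : ∀ {α β} → N α β ≡ true → to col β ∈ row α
      ones {α} {β} e =
        lookup⇒[]= _ _ (Equivalence.to (proj₂ (proj₂ (proj₂ found)) α β) e)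

      zeros : ∀ {α β} → N α β ≡ false → to col β ∉ row α
      zeros {α} {β} e x∈ with () ←
        trans (sym e) (Equivalence.from (proj₂ (proj₂ (proj₂ found)) α β) ([]=⇒lookup x∈))

    no-singleton : ¬ singleton (2 + k) FoundIn family
    no-singleton found
      with _ , eq , covers ← zero-row (to (proj₁ found) zero) (Found.col found)
             (λ β → Found.zeros found refl)
      with _  , a≡ ← covers {a} (subst (a ∉_) (sym eq) λ ())
         | βb , b≡ ← covers {b} (subst (b ∉_) (sym eq) λ { (there ()) })
         | _  , d≡ ← covers {d} (subst (d ∉_) (sym eq) λ { (there (there ())) }) =
      -- Row `suc βb` has its only one in the column of b, so it omits a and d.
      b∈set⇒a∈⊎d∈ (to (proj₁ found) (suc βb))
        (subst (_∈ row (suc βb)) b≡ (ones (⌊⌋-true (_ ℕ.≟ _) refl)))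
        (avoids a≡ λ ()) (avoids d≡ λ ())
      where
      open Found found
      avoids : ∀ {β x} → to col β ≡ x → x ≢ b → x ∉ row (suc βb)
      avoids {β} refl x≢b = zeros {suc βb} (⌊⌋-false (_ ℕ.≟ _) λ e →
        x≢b (trans (cong (to col) (sym (toℕ-injective (ℕ.suc-injective e)))) b≡))

    no-cosingleton : ¬ cosingleton (2 + k) FoundIn family
    no-cosingleton found
      -- The last row index exceeds every column index, so this row has no zero.
      with F , eq , ∣F∣ , covers ← full-row (to (proj₁ found) (fromℕ (2 + k))) (Found.col found)
             (λ β → Found.ones found (cong not (⌊⌋-false (_ ℕ.≟ _) (ℕ.>⇒≢ (toℕ<toℕ-fromℕ β)))))
      with βd , d≡ ← covers {d} (subst (d ∈_) (sym eq) (there (there here))) =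
      -- Row `inject₁ βd` has its only zero in the column of d.
      no-set-missing-only-d (to (proj₁ found) (inject₁ βd)) F ∣F∣ d∉ ⊇
      where
      open Found found
      d∉ : d ∉ row (inject₁ βd)
      d∉ = subst (_∉ row (inject₁ βd)) d≡
        (zeros (cong not (⌊⌋-true (_ ℕ.≟ _) (toℕ-inject₁ βd))))

      ⊇ : ∀ {x} → x ∈ outside ∷ inside ∷ inside ∷ F → x ≢ d → x ∈ row (inject₁ βd)
      ⊇ {x} x∈ x≢d with covers {x} (subst (x ∈_) (sym eq) x∈)
      ... | β , refl = ones {inject₁ βd} (cong not (⌊⌋-false (_ ℕ.≟ _) λ e →
        x≢d (trans (cong (to col) (sym (toℕ-injective (trans (sym (toℕ-inject₁ βd)) e)))) d≡)))

    no-monotone : ¬ monotone (2 + k) FoundIn family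
    no-monotone found
      with _ , eq , covers ← zero-row (to (proj₁ found) zero) (Found.col found)
             (λ β → Found.zeros found refl)
      with β , a≡ ← covers {a} (subst (a ∉_) (sym eq) λ ()) =
      a∉full (full-row (to (proj₁ found) (fromℕ (2 + k))) col all-ones)
      where
      open Found found
      all-ones : ∀ β → to col β ∈ row (fromℕ (2 + k))
      all-ones β = ones (⌊⌋-true (_ ℕ.≤? _) (toℕ<toℕ-fromℕ β))

      a∉full : ¬ (∃[ F ] row (fromℕ (2 + k)) ≡ outside ∷ inside ∷ inside ∷ F × _)
      a∉full (F , eq , _) with () ← subst (a ∈_) eq (subst (_∈ _) a≡ (all-ones β))

    forces⇒size≤ : ∀ {s} → Forces (suc k) (suc k) s →
                   (3 + m) C suc k + m C k ≤ s
    forces⇒size≤ {s} forces = ℕ.≮⇒≥ λ s<size →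
      [ no-singleton , [ no-cosingleton , no-monotone ∘ subst monotone-FoundIn (ℕ.⊓-idem (2 + k)) ]′ ]′
        (forces family (exceeds s<size))
      where
      monotone-FoundIn : ℕ → Set
      monotone-FoundIn n = monotone n FoundIn family

      exceeds : s < (3 + m) C suc k + m C k → family Exceeds s
      exceeds s<size =
        -- `s<size` embeds the `suc s` indices into the sum of the two binomials, which is split
        -- between the two kinds of members.
        (nCk↣Layer (3 + m) (suc k) ⊎-↣ nCk↣Layer m k) ↣-∘
        (Inverse⇒Injection +↔⊎ ↣-∘
          mk↣ {to = λ i → inject≤ i s<size} (inject≤-injective s<size s<size _ _))

proposition1 : ∀ (l : ℕ) → l ≥ 2 → ∀ (s : ℕ) → IsS l l s →
    s ≥ ((2 * l) C l) + ((2 * l ∸ 3) C (l ∸ 1))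
proposition1 (suc k) l≥2 s (forces , _) =
  subst (λ n → n C suc k + (2 * suc k ∸ 3) C k ≤ s) 3+m≡2l
    (Construction.forces⇒size≤ (2 * suc k ∸ 3) k (trans 3+m≡2l 2l≡) forces)
  where
  3+m≡2l : 3 + (2 * suc k ∸ 3) ≡ 2 * suc k
  -- Since 3 ≤ 4 ≤ 2l, the subtraction 2l ∸ 3 is not truncated.
  3+m≡2l = ℕ.m+[n∸m]≡n (≤-trans (ℕ.n≤1+n 3) (ℕ.*-monoʳ-≤ 2 l≥2))

  2l≡ : 2 * suc k ≡ 2 + k + k
  2l≡ = cong suc (trans (ℕ.+-suc k (k + 0)) (cong (λ n → suc (k + n)) (ℕ.+-identityʳ k)))
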